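{- Let $\mathcal{A}$ be a finite set of chords of a fixed circle such that the circle graph $G(\mathcal{A})$ does not contain $K_4$ as a subgraph. Then $G(\mathcal{A})$ admits a proper coloring with at most $30$ colors; that is, $\chi(G(\mathcal{A}))\le 30$.
   Context: Fix a circle. For a finite set $\mathcal{A}$ of chords of this circle, the circle graph $G(\mathcal{A})$ has vertex set $\mathcal{A}$, and two chords are adjacent if and only if they have a common inner point (i.e. they cross). A proper coloring of a graph assigns colors to vertices so that adjacent vertices receive different colors; a coloring of a set of chords means a proper coloring of the corresponding circle graph. -}

module Defs where

open import Data.Nat using (ℕ; _<_)
open import Data.Fin using (Fin)
open import Data.Product using (_×_)
open import Data.Sum using (_⊎_)
open import Relation.Binary.PropositionalEquality using (_≡_; _≢_)

-- A chord of the fixed circle.  Only the cyclic order of endpoints matters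
-- for crossing, so we cut the circle at a point that is not an endpoint and
-- label points by natural numbers in their order along the resulting arc.
-- A chord has two distinct endpoints  left < right.
record Chord : Set where
  constructor chord
  field
    left  : ℕ
    right : ℕ
    left<right : left < right
open Chord public

-- Two chords have a common inner point iff their endpoints strictly interleave.
-- (Chords sharing an endpoint meet only at that endpoint, hence do not cross.)
Cross : Chord → Chord → Set
Cross c d =
  (left c < left d × left d < right c × right c < right d)
  ⊎ (left d < left c × left c < right d × right d < right c)

-- A finite set of n chords: an injective family  Fin n → Chord
-- (distinct chords = distinct endpoint pairs).
DistinctChords : {n : ℕ} → (Fin n → Chord) → Set
DistinctChords {n} A =
  (i j : Fin n) → left (A i) ≡ left (A j) → right (A i) ≡ right (A j) → i ≡ j

CircleAdj : {n : ℕ} → (Fin n → Chord) → Fin n → Fin n → Set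
CircleAdj A i j = Cross (A i) (A j)

ContainsK4 : {n : ℕ} → (Fin n → Chord) → Set
ContainsK4 {n} A =
  Σ4 λ a b c d →
    (a ≢ b × a ≢ c × a ≢ d × b ≢ c × b ≢ d × c ≢ d)
    × (CircleAdj A a b × CircleAdj A a c × CircleAdj A a d
       × CircleAdj A b c × CircleAdj A b d × CircleAdj A c d)
  where
  open import Data.Product using (Σ)
  Σ4 : (Fin n → Fin n → Fin n → Fin n → Set) → Set
  Σ4 P = Σ (Fin n) λ a → Σ (Fin n) λ b → Σ (Fin n) λ c → Σ (Fin n) λ d → P a b c d

ProperColoring : {n : ℕ} → (Fin n → Chord) → (k : ℕ) → (Fin n → Fin k) → Set
ProperColoring {n} A k col = (i j : Fin n) → CircleAdj A i j → col i ≢ col j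

{-# OPTIONS --safe #-}

-- Divide and conquer over segments of the line.  A cut of a segment S splits it in two; the chords
-- of S passing over the cut form a permutation graph without K₄, so three fresh colours, given by
-- the length of the longest chain below a chord, suffice for them.  What remains inside a
-- subsegment only has to avoid the colours of the chords with exactly one end there ("stubs"), and
-- each cut adds at most three such colours.
-- The number of stub colours stays bounded because of sparsity.  Call level of a stub of S its
-- height among all stubs of S (at most three levels).  At a fixed level, two adjacent intervals of S
-- have at most one stub colour in common, so W, the number of (level, colour) pairs, satisfies
-- W(x,y) + W(y,z) ≤ W(x,z) + 3.  If S sees at most 21 colours then W ≤ 63, and as 12 + 6 * 9 > 63 it
-- splits into one single point and seven intervals seeing at most 12 colours each.  Making these
-- seven cuts as a binary tree of depth three raises 21 to 24 and 27 colours before the last cuts,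
-- which still leaves three of the 30 free, and every final piece sees at most 12 + 9 = 21 colours.
module Submission where

open import Defs
open import Data.Nat
open import Data.Nat.Properties hiding (suc-injective; 0≢1+n)
import Data.Nat.Properties as ℕ
open import Data.Nat.Tactic.RingSolver using (solve-∀)
open import Data.Fin using (Fin; zero; suc; toℕ)
open import Data.Fin.Properties using (any?; suc-injective; toℕ-injective)
  renaming (_≟_ to _≟ᶠ_; 0≢1+n to 0≢suc)
open import Data.Product
open import Data.Sum using (_⊎_; inj₁; inj₂)
open import Data.Empty using (⊥; ⊥-elim)
open import Algebra.Properties.CommutativeSemigroup ℕ.+-commutativeSemigroup using (interchange)
open import Function using (_∘_)
open import Relation.Nullary
open import Relation.Nullary.Decidable using (¬?; _×-dec_; _⊎-dec_)
open import Relation.Binary.Definitions using (tri<; tri≈; tri>)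
open import Relation.Binary.PropositionalEquality

-- Case distinction and counting over finite types.

pick : {P B : Set} → Dec P → B → B → B
pick (yes _) x _ = x
pick (no _)  _ y = y

pick-yes : ∀ {P B : Set} (d : Dec P) {x y : B} → P → pick d x y ≡ x
pick-yes (yes _) _ = refl
pick-yes (no ¬p) p = ⊥-elim (¬p p)

pick-no : ∀ {P B : Set} (d : Dec P) {x y : B} → ¬ P → pick d x y ≡ y
pick-no (yes p) ¬p = ⊥-elim (¬p p)
pick-no (no _)  _  = refl

bit : {P : Set} → Dec P → ℕ
bit (yes _) = 1
bit (no _)  = 0

cnt : ∀ {n} {P : Fin n → Set} → (∀ i → Dec (P i)) → ℕ
cnt {zero}  P? = 0
cnt {suc n} P? = bit (P? zero) + cnt (P? ∘ suc)

cnt-mono : ∀ {n} {P Q : Fin n → Set} (P? : ∀ i → Dec (P i)) (Q? : ∀ i → Dec (Q i)) →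
  (∀ i → P i → Q i) → cnt P? ≤ cnt Q?
cnt-mono {zero}  P? Q? P⊆Q = z≤n
cnt-mono {suc n} P? Q? P⊆Q =
  +-mono-≤ (bit-mono (P? zero) (Q? zero) (P⊆Q zero)) (cnt-mono (P? ∘ suc) (Q? ∘ suc) (P⊆Q ∘ suc))
  where
  bit-mono : {A B : Set} (a : Dec A) (b : Dec B) → (A → B) → bit a ≤ bit b
  bit-mono (no _)  _       f = z≤n
  bit-mono (yes a) (yes _) f = s≤s z≤n
  bit-mono (yes a) (no ¬b) f = ⊥-elim (¬b (f a))

cnt-∪ : ∀ {n} {P Q R : Fin n → Set}
  (P? : ∀ i → Dec (P i)) (Q? : ∀ i → Dec (Q i)) (R? : ∀ i → Dec (R i)) →
  (∀ i → R i → P i ⊎ Q i) → cnt R? ≤ cnt P? + cnt Q?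
cnt-∪ {zero}  P? Q? R? R⊆P∪Q = z≤n
cnt-∪ {suc n} P? Q? R? R⊆P∪Q = ≤-trans
  (+-mono-≤ (bit-∪ (P? zero) (Q? zero) (R? zero) (R⊆P∪Q zero))
            (cnt-∪ (P? ∘ suc) (Q? ∘ suc) (R? ∘ suc) (R⊆P∪Q ∘ suc)))
  (≤-reflexive (interchange (bit (P? zero)) (bit (Q? zero)) (cnt (P? ∘ suc)) (cnt (Q? ∘ suc))))
  where
  bit-∪ : {A B C : Set} (a : Dec A) (b : Dec B) (c : Dec C) → (C → A ⊎ B) → bit c ≤ bit a + bit b
  bit-∪ a       b       (no _)  f = z≤n
  bit-∪ (yes _) b       (yes _) f = s≤s z≤n
  bit-∪ (no _)  (yes _) (yes _) f = s≤s z≤n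
  bit-∪ (no ¬a) (no ¬b) (yes c) f with f c
  ... | inj₁ a = ⊥-elim (¬a a)
  ... | inj₂ b = ⊥-elim (¬b b)

cnt-∩ : ∀ {n} {P Q R : Fin n → Set}
  (P? : ∀ i → Dec (P i)) (Q? : ∀ i → Dec (Q i)) (R? : ∀ i → Dec (R i)) →
  (∀ i → P i → R i) → (∀ i → Q i → R i) →
  cnt P? + cnt Q? ≤ cnt R? + cnt (λ i → P? i ×-dec Q? i)
cnt-∩ {zero}  P? Q? R? P⊆R Q⊆R = z≤n
cnt-∩ {suc n} P? Q? R? P⊆R Q⊆R = begin
  (p + ps) + (q + qs)    ≡⟨ interchange p ps q qs ⟩
  (p + q) + (ps + qs)    ≤⟨ +-mono-≤ (bit-∩ (P? zero) (Q? zero) (R? zero) (P⊆R zero) (Q⊆R zero))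
                                     (cnt-∩ (P? ∘ suc) (Q? ∘ suc) (R? ∘ suc) (P⊆R ∘ suc) (Q⊆R ∘ suc)) ⟩
  (r + pq) + (rs + pqs)  ≡⟨ interchange r pq rs pqs ⟩
  (r + rs) + (pq + pqs)  ∎
  where
  open ≤-Reasoning
  p = bit (P? zero)
  q = bit (Q? zero)
  r = bit (R? zero)
  pq = bit (P? zero ×-dec Q? zero)
  ps = cnt (P? ∘ suc)
  qs = cnt (Q? ∘ suc)
  rs = cnt (R? ∘ suc)
  pqs = cnt (λ i → P? (suc i) ×-dec Q? (suc i))
  bit-∩ : {A B C : Set} (a : Dec A) (b : Dec B) (c : Dec C) → (A → C) → (B → C) →
    bit a + bit b ≤ bit c + bit (a ×-dec b)
  bit-∩ (yes a) b       (no ¬c) f g = ⊥-elim (¬c (f a))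
  bit-∩ (no _)  (yes b) (no ¬c) f g = ⊥-elim (¬c (g b))
  bit-∩ (no _)  (no _)  c       f g = z≤n
  bit-∩ (yes _) (yes _) (yes _) f g = ≤-refl
  bit-∩ (yes _) (no _)  (yes _) f g = ≤-refl
  bit-∩ (no _)  (yes _) (yes _) f g = ≤-refl

cnt-none : ∀ {n} {P : Fin n → Set} (P? : ∀ i → Dec (P i)) → (∀ i → ¬ P i) → cnt P? ≡ 0
cnt-none {zero}  P? ¬P = refl
cnt-none {suc n} P? ¬P with P? zero
... | yes p = ⊥-elim (¬P zero p)
... | no _  = cnt-none (P? ∘ suc) (¬P ∘ suc)

cnt-subsingleton : ∀ {n} {P : Fin n → Set} (P? : ∀ i → Dec (P i)) →
  (∀ i j → P i → P j → i ≡ j) → cnt P? ≤ 1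
cnt-subsingleton {zero}  P? P! = z≤n
cnt-subsingleton {suc n} P? P! with P? zero
... | no _  = cnt-subsingleton (P? ∘ suc) λ i j p q → suc-injective (P! (suc i) (suc j) p q)
... | yes p = s≤s (≤-reflexive (cnt-none (P? ∘ suc) λ i q → 0≢suc (P! zero (suc i) p q)))

cnt-∁ : ∀ {n} {P : Fin n → Set} (P? : ∀ i → Dec (P i)) → cnt P? + cnt (λ i → ¬? (P? i)) ≡ n
cnt-∁ {zero}  P? = refl
cnt-∁ {suc n} P? with P? zero
... | yes _ = cong suc (cnt-∁ (P? ∘ suc))
... | no _  = trans (+-suc _ _) (cong suc (cnt-∁ (P? ∘ suc)))

cnt-image : ∀ {k n} (e : Fin k → Fin n) → cnt (λ i → any? λ j → e j ≟ᶠ i) ≤ k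
cnt-image {zero}  e = ≤-reflexive (cnt-none (λ i → any? λ j → e j ≟ᶠ i) λ { _ (() , _) })
cnt-image {suc k} e = ≤-trans
  (cnt-∪ (λ i → e zero ≟ᶠ i) (λ i → any? λ j → e (suc j) ≟ᶠ i) (λ i → any? λ j → e j ≟ᶠ i)
    λ { _ (zero , q) → inj₁ q ; _ (suc j , q) → inj₂ (j , q) })
  (+-mono-≤ (cnt-subsingleton (λ i → e zero ≟ᶠ i) λ { _ _ refl refl → refl }) (cnt-image (e ∘ suc)))

choose : ∀ {n} k {P : Fin n → Set} (P? : ∀ i → Dec (P i)) → k ≤ cnt P? →
  Σ (Fin k → Fin n) λ e → (∀ i → P (e i)) × (∀ i j → e i ≡ e j → i ≡ j)
choose zero P? k≤ = (λ ()) , (λ ()) , λ ()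
choose {zero}  (suc k) P? ()
choose {suc n} (suc k) {P} P? k≤ with P? zero
... | no _ =
  let e , Pe , inj = choose (suc k) (P? ∘ suc) k≤
  in suc ∘ e , Pe , λ i j q → inj i j (suc-injective q)
... | yes p =
  let e , Pe , inj = choose k (P? ∘ suc) (s≤s⁻¹ k≤)
      e' : Fin (suc k) → Fin (suc n)
      e' = λ { zero → zero ; (suc i) → suc (e i) }
      Pe' : ∀ i → P (e' i)
      Pe' = λ { zero → p ; (suc i) → Pe i }
      inj' : ∀ i j → e' i ≡ e' j → i ≡ j
      inj' = λ { zero zero _ → refl ; zero (suc j) () ; (suc i) zero ()
               ; (suc i) (suc j) q → cong suc (inj i j (suc-injective q)) }
  in e' , Pe' , inj'

-- Heights in a relation without chains of four elements.

module Height {n : ℕ} {U : Fin n → Set} (U? : ∀ X → Dec (U X))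
  {R : Fin n → Fin n → Set} (R? : ∀ X Y → Dec (R X Y))
  (no4 : ∀ {w x y z} → U w → U x → U y → U z → R w x → R x y → R y z → ⊥) where

  -- With chains of at most three elements, the height of `X` is settled by two questions: does it
  -- have a predecessor, and does it have one that itself has a predecessor?
  Above Above² : Fin n → Set
  Above X  = ∃ λ K → U K × R K X
  Above² X = ∃ λ K → U K × R K X × Above K

  above? : ∀ X → Dec (Above X)
  above? X = any? λ K → U? K ×-dec R? K X

  above²? : ∀ X → Dec (Above² X)
  above²? X = any? λ K → U? K ×-dec R? K X ×-dec above? K

  height : Fin n → Fin 3
  height X with above²? X | above? X
  ... | yes _ | _     = suc (suc zero)
  ... | no _  | yes _ = suc zero
  ... | no _  | no _  = zero

  -- A chain ending at `X` extends by `Y`; if it already has three elements, the extension is a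
  -- forbidden chain of four.
  height-mono : ∀ {X Y} → U X → U Y → R X Y → toℕ (height X) < toℕ (height Y)
  height-mono {X} {Y} uX uY XY with above²? X | above? X | above²? Y | above? Y
  ... | yes (K , uK , KX , J , uJ , JK) | _ | _ | _ = ⊥-elim (no4 uJ uK uX uY JK KX XY)
  ... | no _ | yes _ | yes _ | _     = s≤s (s≤s z≤n)
  ... | no _ | yes a | no ¬b | _     = ⊥-elim (¬b (X , uX , XY , a))
  ... | no _ | no _  | yes _ | _     = s≤s z≤n
  ... | no _ | no _  | no _  | yes _ = s≤s z≤n
  ... | no _ | no _  | no _  | no ¬b = ⊥-elim (¬b (X , uX , XY))

  height-1 : ∀ {K} → Above K → ¬ Above² K → toℕ (height K) ≡ 1
  height-1 {K} a ¬b with above²? K | above? K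
  ... | yes b | _     = ⊥-elim (¬b b)
  ... | no _  | yes _ = refl
  ... | no _  | no ¬a = ⊥-elim (¬a a)

  height-0 : ∀ {K} → ¬ Above K → toℕ (height K) ≡ 0
  height-0 {K} ¬a with above²? K | above? K
  ... | yes (J , uJ , JK , _) | _ = ⊥-elim (¬a (J , uJ , JK))
  ... | no _ | yes a = ⊥-elim (¬a a)
  ... | no _ | no _  = refl

  -- A longest chain ending at `X` passes through a predecessor exactly one lower: were the chosen
  -- `K` any higher, `X` would be higher too, or a chain of four would arise. This supplies the
  -- witness in `descend` for the chords of a new cut.
  height-pred : ∀ {X} → U X → toℕ (height X) ≡ 0
    ⊎ ∃ λ K → U K × R K X × toℕ (height X) ≡ suc (toℕ (height K))
  height-pred {X} uX with above²? X | above? X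
  ... | yes (K , uK , KX , a) | _ = inj₂ (K , uK , KX , cong suc (sym (height-1 a
          λ { (J , uJ , JK , I , uI , IJ) → no4 uI uJ uK uX IJ JK KX })))
  ... | no ¬b | yes (K , uK , KX) = inj₂ (K , uK , KX , cong suc (sym (height-0
          λ a → ¬b (K , uK , KX , a))))
  ... | no _ | no _ = inj₁ refl

-- Colours seen by an interval, and coherent colourings of stubs.

module _ {n κ : ℕ} {U : Fin n → Set} (U? : ∀ X → Dec (U X))
  (inn : Fin n → ℕ) (col : Fin n → Fin κ) where

  Seen : ℕ → ℕ → Fin κ → Set
  Seen x y c = ∃ λ X → U X × (x ≤ inn X × inn X < y) × col X ≡ c

  seen? : ∀ x y c → Dec (Seen x y c)
  seen? x y c = any? λ X → U? X ×-dec ((x ≤? inn X) ×-dec (inn X <? y)) ×-dec (col X ≟ᶠ c)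

  visible : ℕ → ℕ → ℕ
  visible x y = cnt (seen? x y)

-- Stubs of a segment: inn is the end inside it, out the position of the other end in the cyclic
-- order starting right after the segment.  piv is the cut the chord was coloured at and ht its
-- height among the chords coloured at that cut.  In descend, the chord K that witnesses the height
-- of X need not be a stub of the segment, but then its inner end precedes that of Y, which forces
-- ht X ≤ ht Y; this form is inherited by subsegments.
record Coherent {n κ : ℕ} (U : Fin n → Set) (inn out : Fin n → ℕ)
  (col : Fin n → Fin κ) (piv ht : Fin n → ℕ) : Set where
  field
    convex : ∀ {X M Y} → U X → U M → U Y → out X ≤ out M → out M ≤ out Y →
      piv X ≡ piv Y → piv X ≡ piv M
    ascend : ∀ {X Y} → U X → U Y → piv X ≡ piv Y → inn X < inn Y → out X < out Y → ht X < ht Y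
    descend : ∀ {X Y} → U X → U Y → piv X ≡ piv Y → out X ≤ out Y → inn Y ≤ inn X →
      ht X ≤ ht Y ⊎ ∃ λ K → U K × piv K ≡ piv X × inn K < inn X × out K < out X
                            × ht X ≡ suc (ht K) × inn Y ≤ inn K
    class⇒col : ∀ {X Y} → U X → U Y → piv X ≡ piv Y → ht X ≡ ht Y → col X ≡ col Y
    col⇒class : ∀ {X Y} → U X → U Y → col X ≡ col Y → piv X ≡ piv Y × ht X ≡ ht Y

-- A binary tree of cuts of depth j whose pieces are shorter than s and see at most k colours.
Plan : (ℕ → ℕ → ℕ) → ℕ → ℕ → ℕ → ℕ → ℕ → Set
Plan C k s zero    x y = C x y ≤ k × y ∸ x < s
Plan C k s (suc j) x y = ∃ λ c → x ≤ c × c ≤ y × Plan C k s j x c × Plan C k s j c y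

-- Greedy choice of the cuts.

module Greedy {C W : ℕ → ℕ → ℕ} {lo hi : ℕ} (lo+1<hi : suc lo < hi)
  (C-empty : ∀ x → C x x ≡ 0) (C-suc : ∀ x y → C x (suc y) ≤ C x y + 1)
  (C≤W : ∀ x y → C x y ≤ W x y)
  (W-split : ∀ {x y z} → x ≤ y → y ≤ z → W x y + W y z ≤ W x z + 3)
  (W≤63 : ∀ {x y} → lo ≤ x → y ≤ hi → W x y ≤ 63) where

  -- The right end advances one point at a time. Each point adds at most one colour, so the count
  -- cannot jump over 12. The distance `d` left to `hi` makes the recursion terminate.
  extend : ∀ d {x y} → y + d ≡ hi → C x y ≤ 12 →
    ∃ λ z → y ≤ z × z ≤ hi × C x z ≤ 12 × (z ≡ hi ⊎ 12 ≤ C x z)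
  extend zero {x} {y} y+0≡hi ok = y , ≤-refl , ≤-reflexive y≡hi , ok , inj₁ y≡hi
    where y≡hi = trans (sym (+-identityʳ y)) y+0≡hi
  extend (suc d) {x} {y} y+d≡hi ok with 12 ≤? C x y
  ... | yes full = y , ≤-refl , m+n≤o⇒m≤o y (≤-reflexive y+d≡hi) , ok , inj₂ full
  ... | no ¬full =
    let z , y<z , rest = extend d (trans (sym (+-suc y d)) y+d≡hi)
          (≤-trans (C-suc x y) (subst (_≤ 12) (sym (+-comm (C x y) 1)) (≰⇒> ¬full)))
    in z , <⇒≤ y<z , rest

  -- The invariant after `k` cells: a first full cell contributes `12 = 3 + 9` to `W`, and each
  -- further one at least `12 - 3 = 9`, since `W-split` loses three.
  Reached : ℕ → ℕ → Set
  Reached k x = suc lo ≤ x × x ≤ hi × (x ≡ hi ⊎ 3 + 9 * k ≤ W (suc lo) x)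

  Leaf : ℕ → ℕ → Set
  Leaf = Plan C 12 (hi ∸ lo) 0

  -- Starting to the right of `lo` makes every cell strictly shorter than the segment, even if it
  -- runs up to `hi`; this is why the point `lo` becomes a piece of its own.
  cell : ∀ {x} → suc lo ≤ x → x ≤ hi →
    ∃ λ y → x ≤ y × y ≤ hi × Leaf x y × (y ≡ hi ⊎ 12 ≤ C x y)
  cell {x} lo<x x≤hi =
    let y , x≤y , y≤hi , ok , end = extend (hi ∸ x) (m+[n∸m]≡n x≤hi)
                                      (subst (_≤ 12) (sym (C-empty x)) z≤n)
    in y , x≤y , y≤hi , (ok , ≤-<-trans (∸-monoˡ-≤ x y≤hi) (∸-monoʳ-< lo<x x≤hi)) , end

  first : ∃ λ y → suc lo ≤ y × Leaf (suc lo) y × Reached 1 y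
  first with cell ≤-refl (<⇒≤ lo+1<hi)
  ... | y , x≤y , y≤hi , leaf , inj₁ y≡hi = y , x≤y , leaf , x≤y , y≤hi , inj₁ y≡hi
  ... | y , x≤y , y≤hi , leaf , inj₂ full =
    y , x≤y , leaf , x≤y , y≤hi , inj₂ (≤-trans full (C≤W (suc lo) y))

  next : ∀ {k x} → Reached k x → ∃ λ y → x ≤ y × Leaf x y × Reached (suc k) y
  next {k} {x} (lo<x , x≤hi , r) with cell lo<x x≤hi
  ... | y , x≤y , y≤hi , leaf , inj₁ y≡hi = y , x≤y , leaf , ≤-trans lo<x x≤y , y≤hi , inj₁ y≡hi
  ... | y , x≤y , y≤hi , leaf , inj₂ full = y , x≤y , leaf , ≤-trans lo<x x≤y , y≤hi , reached r
    where
    open ≤-Reasoning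
    rearrange : ∀ k → 3 + 9 * suc k + 3 ≡ (3 + 9 * k) + 12
    rearrange = solve-∀
    reached : x ≡ hi ⊎ 3 + 9 * k ≤ W (suc lo) x → y ≡ hi ⊎ 3 + 9 * suc k ≤ W (suc lo) y
    reached (inj₁ x≡hi) = inj₁ (≤-antisym y≤hi (subst (_≤ y) x≡hi x≤y))
    reached (inj₂ w) = inj₂ (+-cancelʳ-≤ 3 _ _ (begin
      3 + 9 * suc k + 3     ≡⟨ rearrange k ⟩
      (3 + 9 * k) + 12      ≤⟨ +-mono-≤ w (≤-trans full (C≤W x y)) ⟩
      W (suc lo) x + W x y  ≤⟨ W-split lo<x x≤y ⟩
      W (suc lo) y + 3      ∎))

  plan : Plan C 12 (hi ∸ lo) 3 lo hi
  plan with first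
  ... | c₁ , p₁ , l₁ , r₁ with next {1} r₁
  ... | c₂ , p₂ , l₂ , r₂ with next {2} r₂
  ... | c₃ , p₃ , l₃ , r₃ with next {3} r₃
  ... | c₄ , p₄ , l₄ , r₄ with next {4} r₄
  ... | c₅ , p₅ , l₅ , r₅ with next {5} r₅
  ... | c₆ , p₆ , l₆ , r₆ with next {6} r₆
  -- At least `3 + 9 * 7 = 66` pairs would be seen up to `c₇`, against the bound 63.
  ... | c₇ , p₇ , l₇ , (lo<c₇ , c₇≤hi , inj₂ w) =
    ⊥-elim (<⇒≱ (≤-<-trans (W≤63 (n≤1+n lo) c₇≤hi) (s≤s (m≤m+n 63 2))) w)
  -- The seven cells exhaust the segment; with the single point in front they are the eight leaves
  -- of a balanced tree with root `c₃`.
  ... | c₇ , p₇ , l₇ , (_ , _ , inj₁ refl) =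
    c₃ , ≤-trans (n≤1+n lo) (≤-trans p₁ (≤-trans p₂ p₃)) , ≤-trans p₄ (≤-trans p₅ (≤-trans p₆ p₇))
    , (c₁ , ≤-trans (n≤1+n lo) p₁ , ≤-trans p₂ p₃
      , (suc lo , n≤1+n lo , p₁ , l₀ , l₁) , (c₂ , p₂ , p₃ , l₂ , l₃))
    , (c₅ , ≤-trans p₄ p₅ , ≤-trans p₆ p₇
      , (c₄ , p₄ , p₅ , l₄ , l₅) , (c₆ , p₆ , p₇ , l₆ , l₇))
    where
    l₀ : Leaf lo (suc lo)
    l₀ = ≤-trans (C-suc lo lo) (subst (λ m → m + 1 ≤ 12) (sym (C-empty lo)) (s≤s z≤n))
       , subst (_< hi ∸ lo) (sym (m+n∸n≡m 1 lo)) (subst (_≤ hi ∸ lo) (m+n∸n≡m 2 lo) (∸-monoˡ-≤ lo lo+1<hi))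

-- Sparsity of the stub colours at a fixed level.

module Staircase {n κ : ℕ} {U : Fin n → Set} (U? : ∀ X → Dec (U X)) {inn out : Fin n → ℕ}
  {col : Fin n → Fin κ} {piv ht : Fin n → ℕ} (coherent : Coherent U inn out col piv ht)
  (inn-injective : ∀ {X Y} → U X → U Y → inn X ≡ inn Y → X ≡ Y)
  (no4 : ∀ {w x y z} → U w → U x → U y → U z → inn w < inn x × out w < out x →
    inn x < inn y × out x < out y → inn y < inn z × out y < out z → ⊥) where

  open Coherent coherent
  open Height U? {λ X Y → inn X < inn Y × out X < out Y}
    (λ X Y → (inn X <? inn Y) ×-dec (out X <? out Y)) no4

  level : Fin n → ℕ
  level X = toℕ (height X)

  -- A longest chain of pivot piv X ending at X and a longest chain of stubs ending at Y can be
  -- recombined into a chain of that pivot ending at Y and a chain of stubs ending at X.  f is fuel.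
  exchange : ∀ f {X Y} → ht X + level Y < f → U X → U Y → piv X ≡ piv Y →
    out X ≤ out Y → inn Y ≤ inn X → ht X + level Y ≤ ht Y + level X
  exchange (suc f) {X} {Y} (s≤s fuel) uX uY piv≡ oX≤oY iY≤iX
    with descend uX uY piv≡ oX≤oY iY≤iX
  ... | inj₂ (K , uK , pivK , iK<iX , oK<oX , hX , iY≤iK) rewrite hX = begin
    suc (ht K + level Y)  ≤⟨ s≤s (exchange f fuel uK uY (trans pivK piv≡)
                               (≤-trans (<⇒≤ oK<oX) oX≤oY) iY≤iK) ⟩
    suc (ht Y + level K)  ≡⟨ sym (+-suc (ht Y) (level K)) ⟩
    ht Y + suc (level K)  ≤⟨ +-monoʳ-≤ (ht Y) (height-mono uK uX (iK<iX , oK<oX)) ⟩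
    ht Y + level X        ∎
    where open ≤-Reasoning
  ... | inj₁ hX≤hY with height-pred uY
  ...   | inj₁ LY≡0 = +-mono-≤ hX≤hY (subst (_≤ level X) (sym LY≡0) z≤n)
  ...   | inj₂ (M , uM , (iM<iY , oM<oY) , LY) with out X ≤? out M
  -- Here `M` also lies below `X`, so `level Y = level M + 1 ≤ level X`.
  ...     | no oX≰oM = +-mono-≤ hX≤hY (subst (_≤ level X) (sym LY)
              (height-mono uM uX (<-≤-trans iM<iY iY≤iX , ≰⇒> oX≰oM)))
  ...     | yes oX≤oM = begin
    ht X + level Y        ≡⟨ cong (ht X +_) LY ⟩
    ht X + suc (level M)  ≡⟨ +-suc (ht X) (level M) ⟩
    suc (ht X + level M)  ≤⟨ s≤s (exchange f
                               (subst (_≤ f) (trans (cong (ht X +_) LY) (+-suc (ht X) (level M))) fuel)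
                               uX uM pivM oX≤oM (≤-trans (<⇒≤ iM<iY) iY≤iX)) ⟩
    suc (ht M) + level X  ≤⟨ +-monoˡ-≤ (level X)
                               (ascend uM uY (trans (sym pivM) piv≡) iM<iY oM<oY) ⟩
    ht Y + level X        ∎
    where
    open ≤-Reasoning
    pivM = convex uX uM uY oX≤oM (<⇒≤ oM<oY) piv≡

  -- The equal levels cancel from `exchange`.
  ht-mono : ∀ {X Y} → U X → U Y → piv X ≡ piv Y → level X ≡ level Y →
    out X ≤ out Y → inn Y ≤ inn X → ht X ≤ ht Y
  ht-mono {X} {Y} uX uY piv≡ L≡ o i = +-cancelʳ-≤ (level Y) (ht X) (ht Y)
    (subst (λ m → ht X + level Y ≤ ht Y + m) L≡ (exchange _ ≤-refl uX uY piv≡ o i))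

  SeenAt : ℕ → ℕ → ℕ → Fin κ → Set
  SeenAt ℓ x y c = ∃ λ X → U X × level X ≡ ℓ × (x ≤ inn X × inn X < y) × col X ≡ c

  seenAt? : ∀ ℓ x y c → Dec (SeenAt ℓ x y c)
  seenAt? ℓ x y c = any? λ X → U? X ×-dec (level X ≟ ℓ)
    ×-dec ((x ≤? inn X) ×-dec (inn X <? y)) ×-dec (col X ≟ᶠ c)

  -- Stubs of one level are incomparable, hence form a descending staircase.
  out-antitone : ∀ {X Y} → U X → U Y → level X ≡ level Y → inn Y < inn X → out X ≤ out Y
  out-antitone uX uY L≡ i = ≮⇒≥ λ o → <-irrefl (sym L≡) (height-mono uY uX (i , o))

  -- A colour seen on both sides of y at one level forces the outer ends of the other colour's
  -- stubs between its own, and conversely; by convexity and ht-mono the two classes coincide.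
  both-sides-unique : ∀ {ℓ x y z} c d →
    SeenAt ℓ x y c × SeenAt ℓ y z c → SeenAt ℓ x y d × SeenAt ℓ y z d → c ≡ d
  both-sides-unique c d ((J , uJ , LJ , (_ , J<y) , cJ) , (X , uX , LX , (y≤X , _) , cX))
              ((J′ , uJ′ , LJ′ , (_ , J′<y) , dJ′) , (X′ , uX′ , LX′ , (y≤X′ , _) , dX′)) =
    trans (sym cX) (trans (class⇒col uX uJ′ pivXJ′ (≤-antisym htXJ′ htJ′X)) dJ′)
    where
    classXJ = col⇒class uX uJ (trans cX (sym cJ))
    classXJ′ = col⇒class uX′ uJ′ (trans dX′ (sym dJ′))
    pivXJ = proj₁ classXJ
    pivXJ′′ = proj₁ classXJ′
    LXJ′ = trans LX (sym LJ′)
    LX′J = trans LX′ (sym LJ)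
    iJ′X = <-≤-trans J′<y y≤X
    iJX′ = <-≤-trans J<y y≤X′
    oXJ′ = out-antitone uX uJ′ LXJ′ iJ′X
    oX′J = out-antitone uX′ uJ LX′J iJX′
    pivXJ′ : piv X ≡ piv J′
    -- Whichever of `J` and `J′` has the smaller outer end lies between the two stubs of the other
    -- colour, so `convex` applies to it.
    pivXJ′ with ≤-total (out J) (out J′)
    ... | inj₁ J≤J′ = trans pivXJ (trans (sym (convex uX′ uJ uJ′ oX′J J≤J′ pivXJ′′)) pivXJ′′)
    ... | inj₂ J′≤J = convex uX uJ′ uJ oXJ′ J′≤J pivXJ
    pivX′J : piv X′ ≡ piv J
    pivX′J = trans pivXJ′′ (trans (sym pivXJ′) pivXJ)
    htXJ′ : ht X ≤ ht J′
    htXJ′ = ht-mono uX uJ′ pivXJ′ LXJ′ oXJ′ (<⇒≤ iJ′X)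
    -- The circle closes: `ht J′ = ht X′ ≤ ht J = ht X`.
    htJ′X : ht J′ ≤ ht X
    htJ′X = subst₂ _≤_ (proj₂ classXJ′) (sym (proj₂ classXJ))
      (ht-mono uX′ uJ pivX′J LX′J oX′J (<⇒≤ iJX′))

  C : ℕ → ℕ → ℕ
  C = visible U? inn col

  CAt : ℕ → ℕ → ℕ → ℕ
  CAt ℓ x y = cnt (seenAt? ℓ x y)

  CAt-split : ∀ ℓ {x y z} → x ≤ y → y ≤ z → CAt ℓ x y + CAt ℓ y z ≤ CAt ℓ x z + 1
  CAt-split ℓ {x} {y} {z} x≤y y≤z = ≤-trans
    (cnt-∩ (seenAt? ℓ x y) (seenAt? ℓ y z) (seenAt? ℓ x z)
      (λ { _ (X , u , L , (a , b) , q) → X , u , L , (a , <-≤-trans b y≤z) , q })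
      (λ { _ (X , u , L , (a , b) , q) → X , u , L , (≤-trans x≤y a , b) , q }))
    (+-monoʳ-≤ (CAt ℓ x z)
      (cnt-subsingleton (λ c → seenAt? ℓ x y c ×-dec seenAt? ℓ y z c) both-sides-unique))

  W : ℕ → ℕ → ℕ
  W x y = CAt 0 x y + (CAt 1 x y + CAt 2 x y)

  W-split : ∀ {x y z} → x ≤ y → y ≤ z → W x y + W y z ≤ W x z + 3
  W-split {x} {y} {z} x≤y y≤z = begin
    W x y + W y z  ≡⟨ shuffle (CAt 0 x y) (CAt 1 x y) (CAt 2 x y) (CAt 0 y z) (CAt 1 y z) (CAt 2 y z) ⟩
    (CAt 0 x y + CAt 0 y z) + ((CAt 1 x y + CAt 1 y z) + (CAt 2 x y + CAt 2 y z))
      ≤⟨ +-mono-≤ (split 0) (+-mono-≤ (split 1) (split 2)) ⟩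
    (CAt 0 x z + 1) + ((CAt 1 x z + 1) + (CAt 2 x z + 1))
      ≡⟨ collect (CAt 0 x z) (CAt 1 x z) (CAt 2 x z) ⟩
    W x z + 3      ∎
    where
    open ≤-Reasoning
    split = λ ℓ → CAt-split ℓ x≤y y≤z
    shuffle : ∀ a b c d e f → (a + (b + c)) + (d + (e + f)) ≡ (a + d) + ((b + e) + (c + f))
    shuffle = solve-∀
    collect : ∀ a b c → (a + 1) + ((b + 1) + (c + 1)) ≡ (a + (b + c)) + 3
    collect = solve-∀

  C≤W : ∀ x y → C x y ≤ W x y
  C≤W x y = ≤-trans (cnt-∪ (seenAt? 0 x y) ₁∪₂? (seen? U? inn col x y) cover)
    (+-monoʳ-≤ (CAt 0 x y) (cnt-∪ (seenAt? 1 x y) (seenAt? 2 x y) ₁∪₂? λ _ s → s))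
    where
    ₁∪₂? = λ c → seenAt? 1 x y c ⊎-dec seenAt? 2 x y c
    cover : ∀ c → Seen U? inn col x y c → SeenAt 0 x y c ⊎ (SeenAt 1 x y c ⊎ SeenAt 2 x y c)
    cover c (X , u , r , q) with height X in eq
    ... | zero           = inj₁ (X , u , cong toℕ eq , r , q)
    ... | suc zero       = inj₂ (inj₁ (X , u , cong toℕ eq , r , q))
    ... | suc (suc zero) = inj₂ (inj₂ (X , u , cong toℕ eq , r , q))

  C-empty : ∀ x → C x x ≡ 0
  C-empty x = cnt-none (seen? U? inn col x x) λ { _ (_ , _ , (a , b) , _) → <⇒≱ b a }

  -- Inner ends are distinct, so at most one stub ends at `y`.
  C-suc : ∀ x y → C x (suc y) ≤ C x y + 1
  C-suc x y = ≤-trans (cnt-∪ (seen? U? inn col x y) at? (seen? U? inn col x (suc y)) cover)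
    (+-monoʳ-≤ (C x y) (cnt-subsingleton at? at-unique))
    where
    At : Fin κ → Set
    At c = ∃ λ X → U X × inn X ≡ y × col X ≡ c
    at? : ∀ c → Dec (At c)
    at? c = any? λ X → U? X ×-dec (inn X ≟ y) ×-dec (col X ≟ᶠ c)
    cover : ∀ c → Seen U? inn col x (suc y) c → Seen U? inn col x y c ⊎ At c
    cover c (X , u , (a , b) , q) with m≤n⇒m<n∨m≡n (s≤s⁻¹ b)
    ... | inj₁ lt = inj₁ (X , u , (a , lt) , q)
    ... | inj₂ eq = inj₂ (X , u , eq , q)
    at-unique : ∀ c d → At c → At d → c ≡ d
    at-unique c d (X , uX , iX , cX) (Y , uY , iY , dY)
      with refl ← inn-injective uX uY (trans iX (sym iY)) = trans (sym cX) dY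

  -- Each of the three levels shows at most the 21 colours of the whole segment.
  W≤63 : ∀ {lo hi} → C lo hi ≤ 21 → ∀ {x y} → lo ≤ x → y ≤ hi → W x y ≤ 63
  W≤63 {lo} {hi} few {x} {y} lo≤x y≤hi = +-mono-≤ (at 0) (+-mono-≤ (at 1) (at 2))
    where
    at : ∀ ℓ → CAt ℓ x y ≤ 21
    at ℓ = ≤-trans (cnt-mono (seenAt? ℓ x y) (seen? U? inn col lo hi)
      λ { _ (X , u , _ , (a , b) , q) → X , u , (≤-trans lo≤x a , <-≤-trans b y≤hi) , q }) few

  greedy-plan : ∀ {lo hi} → suc lo < hi → C lo hi ≤ 21 → Plan C 12 (hi ∸ lo) 3 lo hi
  greedy-plan lo+1<hi few = Greedy.plan {C} {W} lo+1<hi C-empty C-suc C≤W W-split (W≤63 few)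

-- Coherence passes from a segment to the pieces of a cut.

module Extension {n κ : ℕ} {U U′ New : Fin n → Set}
  (U? : ∀ X → Dec (U X)) (U′? : ∀ X → Dec (U′ X)) (New? : ∀ X → Dec (New X))
  {inn out inn′ out′ : Fin n → ℕ} {col : Fin n → Fin κ} {piv ht : Fin n → ℕ}
  (coherent : Coherent U inn out col piv ht)
  (c : ℕ) (e : Fin 3 → Fin κ) (e-injective : ∀ i j → e i ≡ e j → i ≡ j) (g : Fin n → Fin 3)
  where

  col′ : Fin n → Fin κ
  col′ X = pick (New? X) (e (g X)) (col X)

  piv′ ht′ : Fin n → ℕ
  piv′ X = pick (New? X) c (piv X)
  ht′ X = pick (New? X) (toℕ (g X)) (ht X)

  -- One argument for both pieces: `U` stands for the stubs of the segment, `U′` for those of a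
  -- piece, `New` for the chords coloured at the cut. The pieces differ in which extreme of the
  -- outer order the new chords occupy, hence the alternative in `separated`.
  module Preserve
    (fresh : ∀ {X} i → U X → col X ≢ e i)
    (piv≢c : ∀ {X Z} → U X → New Z → piv X ≢ c)
    (old : ∀ {X} → U′ X → ¬ New X → U X × inn′ X ≡ inn X × out′ X ≡ out X)
    (between : ∀ {X K Y} → U′ X → ¬ New X → U′ Y → ¬ New Y → U K → inn Y ≤ inn K → inn K < inn X →
      U′ K × ¬ New K)
    (new : ∀ {X} → New X → U′ X)
    (separated : (∀ {X Y} → New X → U′ Y → ¬ New Y → out′ X < out′ Y)
               ⊎ (∀ {X Y} → New X → U′ Y → ¬ New Y → out′ Y < out′ X))
    (g-mono : ∀ {X Y} → New X → New Y → inn′ X < inn′ Y × out′ X < out′ Y → toℕ (g X) < toℕ (g Y))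
    (g-pred : ∀ {X} → New X → toℕ (g X) ≡ 0
      ⊎ ∃ λ K → New K × (inn′ K < inn′ X × out′ K < out′ X) × toℕ (g X) ≡ suc (toℕ (g K)))
    where

    open Coherent

    visible-extended : ∀ x y → visible U′? inn′ col′ x y ≤ visible U? inn col x y + 3
    visible-extended x y = ≤-trans
      (cnt-∪ (seen? U? inn col x y) (λ i → any? λ j → e j ≟ᶠ i) (seen? U′? inn′ col′ x y) split)
      (+-monoʳ-≤ (visible U? inn col x y) (cnt-image e))
      where
      split : ∀ k → Seen U′? inn′ col′ x y k → Seen U? inn col x y k ⊎ ∃ λ j → e j ≡ k
      split k (X , uX , (a , b) , q) with New? X
      ... | yes _ = inj₂ (g X , q)
      ... | no oX =
        let vX , pX , _ = old uX oX
        in inj₁ (X , vX , (subst (x ≤_) pX a , subst (_< y) pX b) , q)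

    -- As the new chords fill one extreme of the outer order, neither kind can be enclosed by the
    -- other. This is what preserves convexity.
    not-between : ∀ {X M Y} → U′ X → U′ M → U′ Y → out′ X ≤ out′ M → out′ M ≤ out′ Y →
      (¬ New X × New M × ¬ New Y) ⊎ (New X × ¬ New M × New Y) → ⊥
    not-between {X} {M} {Y} uX uM uY XM MY = clash separated
      where
      clash : _ → (¬ New X × New M × ¬ New Y) ⊎ (New X × ¬ New M × New Y) → ⊥
      clash (inj₁ s) (inj₁ (oX , nM , oY)) = <⇒≱ (s nM uX oX) XM
      clash (inj₁ s) (inj₂ (nX , oM , nY)) = <⇒≱ (s nY uM oM) MY
      clash (inj₂ s) (inj₁ (oX , nM , oY)) = <⇒≱ (s nM uY oY) MY
      clash (inj₂ s) (inj₂ (nX , oM , nY)) = <⇒≱ (s nX uM oM) XM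

    extended : Coherent U′ inn′ out′ col′ piv′ ht′
    extended .convex {X} {M} {Y} uX uM uY XM MY piv≡ with New? X | New? M | New? Y
    ... | no oX | no oM | no oY =
      let vX , _ , qX = old uX oX
          vM , _ , qM = old uM oM
          vY , _ , qY = old uY oY
      in convex coherent vX vM vY (subst₂ _≤_ qX qM XM) (subst₂ _≤_ qM qY MY) piv≡
    ... | no oX  | yes nM | no oY  = ⊥-elim (not-between uX uM uY XM MY (inj₁ (oX , nM , oY)))
    ... | yes nX | no oM  | yes nY = ⊥-elim (not-between uX uM uY XM MY (inj₂ (nX , oM , nY)))
    ... | yes _  | yes _  | yes _  = refl
    ... | yes nX | _      | no oY  = ⊥-elim (piv≢c (proj₁ (old uY oY)) nX (sym piv≡))
    ... | no oX  | _      | yes nY = ⊥-elim (piv≢c (proj₁ (old uX oX)) nY piv≡)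
    extended .ascend {X} {Y} uX uY piv≡ i o with New? X | New? Y
    ... | no oX | no oY =
      let vX , pX , qX = old uX oX
          vY , pY , qY = old uY oY
      in ascend coherent vX vY piv≡ (subst₂ _<_ pX pY i) (subst₂ _<_ qX qY o)
    ... | yes nX | yes nY = g-mono nX nY (i , o)
    ... | yes nX | no oY  = ⊥-elim (piv≢c (proj₁ (old uY oY)) nX (sym piv≡))
    ... | no oX  | yes nY = ⊥-elim (piv≢c (proj₁ (old uX oX)) nY piv≡)
    extended .descend {X} {Y} uX uY piv≡ o i with New? X | New? Y
    ... | yes nX | no oY  = ⊥-elim (piv≢c (proj₁ (old uY oY)) nX (sym piv≡))
    ... | no oX  | yes nY = ⊥-elim (piv≢c (proj₁ (old uX oX)) nY piv≡)
    ... | yes nX | yes nY with g-pred nX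
    ...   | inj₁ gX≡0 = inj₁ (subst (_≤ toℕ (g Y)) (sym gX≡0) z≤n)
    ...   | inj₂ (K , nK , (iK , oK) , gX) with inn′ Y ≤? inn′ K
    ...     | yes iY≤iK = inj₂ (K , new nK , pick-yes (New? K) nK , iK , oK
                               , trans gX (cong suc (sym (pick-yes (New? K) nK))) , iY≤iK)
    -- Now `K` precedes `Y` in both orders, so `g X = g K + 1 ≤ g Y`.
    ...     | no iY≰iK  = inj₁ (subst (_≤ toℕ (g Y)) (sym gX)
                               (g-mono nK nY (≰⇒> iY≰iK , <-≤-trans oK o)))
    extended .descend {X} {Y} uX uY piv≡ o i | no oX | no oY
      with old uX oX | old uY oY
    ... | vX , pX , qX | vY , pY , qY
      with descend coherent vX vY piv≡ (subst₂ _≤_ qX qY o) (subst₂ _≤_ pY pX i)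
    ...   | inj₁ le = inj₁ le
    ...   | inj₂ (K , vK , pivK , iK , oK , hX , iY≤iK)
      -- The inner end of the old witness lies between those of `Y` and `X`, so the witness survives
      -- as a stub of the piece.
      with between uX oX uY oY vK iY≤iK iK
    ...     | uK , ¬nK with old uK ¬nK
    ...       | _ , pK , qK = inj₂
      (K , uK , trans (pick-no (New? K) ¬nK) pivK , subst₂ _<_ (sym pK) (sym pX) iK
      , subst₂ _<_ (sym qK) (sym qX) oK , trans hX (cong suc (sym (pick-no (New? K) ¬nK)))
      , subst₂ _≤_ (sym pY) (sym pK) iY≤iK)
    extended .class⇒col {X} {Y} uX uY piv≡ ht≡ with New? X | New? Y
    ... | no oX  | no oY  = class⇒col coherent (proj₁ (old uX oX)) (proj₁ (old uY oY)) piv≡ ht≡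
    ... | yes nX | yes nY = cong e (toℕ-injective ht≡)
    ... | yes nX | no oY  = ⊥-elim (piv≢c (proj₁ (old uY oY)) nX (sym piv≡))
    ... | no oX  | yes nY = ⊥-elim (piv≢c (proj₁ (old uX oX)) nY piv≡)
    extended .col⇒class {X} {Y} uX uY col≡ with New? X | New? Y
    ... | no oX  | no oY  = col⇒class coherent (proj₁ (old uX oX)) (proj₁ (old uY oY)) col≡
    ... | yes nX | yes nY = refl , cong toℕ (e-injective (g X) (g Y) col≡)
    ... | yes nX | no oY  = ⊥-elim (fresh (g X) (proj₁ (old uY oY)) (sym col≡))
    ... | no oX  | yes nY = ⊥-elim (fresh (g Y) (proj₁ (old uX oX)) col≡)

-- From chains of crossing chords to K₄.

Cross-irrefl : ∀ {a} → ¬ Cross a a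
Cross-irrefl (inj₁ (lt , _)) = <-irrefl refl lt
Cross-irrefl (inj₂ (lt , _)) = <-irrefl refl lt

Cross-sym : ∀ {a b} → Cross a b → Cross b a
Cross-sym (inj₁ p) = inj₂ p
Cross-sym (inj₂ p) = inj₁ p

-- By transitivity all six pairs of a chain of four cross, and crossing chords are distinct. It
-- serves both for the chords over a cut and for the stubs of a segment.
no-4-chain : ∀ {n} {A : Fin n → Chord} → ¬ ContainsK4 A →
  {U : Fin n → Set} {R : Fin n → Fin n → Set} →
  (∀ {x y z} → R x y → R y z → R x z) →
  (∀ {x y} → U x → U y → R x y → CircleAdj A x y) →
  ∀ {w x y z} → U w → U x → U y → U z → R w x → R x y → R y z → ⊥
no-4-chain {A = A} noK4 tr cr {w} {x} {y} {z} uw ux uy uz wx xy yz =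
  noK4 (w , x , y , z , (≢ w~x , ≢ w~y , ≢ w~z , ≢ x~y , ≢ x~z , ≢ y~z)
       , (w~x , w~y , w~z , x~y , x~z , y~z))
  where
  ≢ : ∀ {a b} → CircleAdj A a b → a ≢ b
  ≢ {a} c refl = Cross-irrefl {A a} c
  w~x = cr uw ux wx
  w~y = cr uw uy (tr wx xy)
  w~z = cr uw uz (tr wx (tr xy yz))
  x~y = cr ux uy xy
  x~z = cr ux uz (tr xy yz)
  y~z = cr uy uz yz

-- Segments, their stubs and the colouring problem inside them.

module Segments {n κ : ℕ} (A : Fin n → Chord) (noK4 : ¬ ContainsK4 A)
  (N : ℕ) (r<N : ∀ X → right (A X) < N)
  (l-injective : ∀ {X Y} → left (A X) ≡ left (A Y) → X ≡ Y)
  (r-injective : ∀ {X Y} → right (A X) ≡ right (A Y) → X ≡ Y)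
  (l≢r : ∀ {X Y} → left (A X) ≢ right (A Y)) where

  l r : Fin n → ℕ
  l X = left (A X)
  r X = right (A X)

  l<r : ∀ X → l X < r X
  l<r X = left<right (A X)

  In : ℕ → ℕ → Fin n → Set
  In lo hi X = lo ≤ l X × r X < hi

  LStub RStub Stub : ℕ → ℕ → Fin n → Set
  LStub lo hi X = l X < lo × lo ≤ r X × r X < hi
  RStub lo hi X = lo ≤ l X × l X < hi × hi ≤ r X
  Stub lo hi X = LStub lo hi X ⊎ RStub lo hi X

  stub? : ∀ lo hi X → Dec (Stub lo hi X)
  stub? lo hi X = ((l X <? lo) ×-dec (lo ≤? r X) ×-dec (r X <? hi))
    ⊎-dec ((lo ≤? l X) ×-dec (l X <? hi) ×-dec (hi ≤? r X))

  -- N exceeds all endpoints, so right stubs precede left stubs in the order of outer ends.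
  inn out : ℕ → Fin n → ℕ
  inn hi X = pick (hi ≤? r X) (l X) (r X)
  out hi X = pick (hi ≤? r X) (r X) (N + l X)

  innL : ∀ {hi X} → r X < hi → inn hi X ≡ r X
  innL {hi} {X} r<hi = pick-no (hi ≤? r X) (<⇒≱ r<hi)

  outL : ∀ {hi X} → r X < hi → out hi X ≡ N + l X
  outL {hi} {X} r<hi = pick-no (hi ≤? r X) (<⇒≱ r<hi)

  innR : ∀ {hi X} → hi ≤ r X → inn hi X ≡ l X
  innR {hi} {X} = pick-yes (hi ≤? r X)

  outR : ∀ {hi X} → hi ≤ r X → out hi X ≡ r X
  outR {hi} {X} = pick-yes (hi ≤? r X)

  Before : ℕ → Fin n → Fin n → Set
  Before hi X Y = inn hi X < inn hi Y × out hi X < out hi Y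

  Before-trans : ∀ {hi x y z} → Before hi x y → Before hi y z → Before hi x z
  Before-trans (a , b) (c , d) = <-trans a c , <-trans b d

  -- Inner and outer ends increasing together make the four ends alternate around the circle. A left
  -- stub never comes before a right one, its outer position being at least `N`.
  stub-cross : ∀ {lo hi X Y} → Stub lo hi X → Stub lo hi Y → Before hi X Y → CircleAdj A X Y
  stub-cross (inj₁ (lX<lo , lo≤rX , rX<hi)) (inj₁ (lY<lo , lo≤rY , rY<hi)) (i , o) =
    inj₁ (+-cancelˡ-< N _ _ (subst₂ _<_ (outL rX<hi) (outL rY<hi) o)
         , <-≤-trans lY<lo lo≤rX , subst₂ _<_ (innL rX<hi) (innL rY<hi) i)
  stub-cross {Y = Y} (inj₁ (lX<lo , lo≤rX , rX<hi)) (inj₂ (lo≤lY , lY<hi , hi≤rY)) (i , o) =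
    ⊥-elim (<-asym (r<N Y) (≤-<-trans (m≤m+n N _) (subst₂ _<_ (outL rX<hi) (outR hi≤rY) o)))
  stub-cross (inj₂ (lo≤lX , lX<hi , hi≤rX)) (inj₁ (lY<lo , lo≤rY , rY<hi)) (i , o) =
    inj₂ (<-≤-trans lY<lo lo≤lX , subst₂ _<_ (innR hi≤rX) (innL rY<hi) i , <-≤-trans rY<hi hi≤rX)
  stub-cross (inj₂ (lo≤lX , lX<hi , hi≤rX)) (inj₂ (lo≤lY , lY<hi , hi≤rY)) (i , o) =
    inj₁ (subst₂ _<_ (innR hi≤rX) (innR hi≤rY) i , <-≤-trans lY<hi hi≤rX
         , subst₂ _<_ (outR hi≤rX) (outR hi≤rY) o)

  inn-injective : ∀ {lo hi X Y} → Stub lo hi X → Stub lo hi Y → inn hi X ≡ inn hi Y → X ≡ Y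
  inn-injective (inj₁ (_ , _ , a)) (inj₁ (_ , _ , b)) q =
    r-injective (trans (sym (innL a)) (trans q (innL b)))
  inn-injective (inj₁ (_ , _ , a)) (inj₂ (_ , _ , b)) q =
    ⊥-elim (l≢r (trans (sym (innR b)) (trans (sym q) (innL a))))
  inn-injective (inj₂ (_ , _ , a)) (inj₁ (_ , _ , b)) q =
    ⊥-elim (l≢r (trans (sym (innR a)) (trans q (innL b))))
  inn-injective (inj₂ (_ , _ , a)) (inj₂ (_ , _ , b)) q =
    l-injective (trans (sym (innR a)) (trans q (innR b)))

  inn-range : ∀ {lo hi X} → Stub lo hi X → lo ≤ inn hi X × inn hi X < hi
  inn-range {lo} {hi} (inj₁ (_ , a , b)) = subst (λ m → lo ≤ m × m < hi) (sym (innL b)) (a , b)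
  inn-range {lo} {hi} (inj₂ (a , b , c)) = subst (λ m → lo ≤ m × m < hi) (sym (innR c)) (a , b)

  record State (lo hi : ℕ) : Set where
    field
      col      : Fin n → Fin κ
      piv ht   : Fin n → ℕ
      coherent : Coherent (Stub lo hi) (inn hi) (out hi) col piv ht
      piv-out  : ∀ {X} → Stub lo hi X → piv X ≤ lo ⊎ hi ≤ piv X
  open State

  load : ∀ {lo hi} → State lo hi → ℕ → ℕ → ℕ
  load {lo} {hi} st = visible (stub? lo hi) (inn hi) (col st)

  load-mono : ∀ {lo hi} (st : State lo hi) {x y x′ y′} → x′ ≤ x → y ≤ y′ → load st x y ≤ load st x′ y′
  load-mono {lo} {hi} st {x} {y} {x′} {y′} x′≤x y≤y′ = cnt-mono
    (seen? (stub? lo hi) (inn hi) (col st) x y) (seen? (stub? lo hi) (inn hi) (col st) x′ y′)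
    λ { _ (X , u , (a , b) , q) → X , u , (≤-trans x′≤x a , <-≤-trans b y≤y′) , q }

  Solution : ∀ lo hi → (Fin n → Fin κ) → Set
  Solution lo hi col = Σ (Fin n → Fin κ) λ f →
    (∀ {X Y} → In lo hi X → In lo hi Y → CircleAdj A X Y → f X ≢ f Y) ×
    (∀ {X Y} → In lo hi X → Stub lo hi Y → CircleAdj A X Y → f X ≢ col Y)

  -- A single cut.

  module Cut {lo hi} (st : State lo hi) {c} (lo≤c : lo ≤ c) (c≤hi : c ≤ hi)
    (room : load st lo hi + 3 ≤ κ) where

    New : Fin n → Set
    New X = lo ≤ l X × l X < c × c ≤ r X × r X < hi

    new? : ∀ X → Dec (New X)
    new? X = (lo ≤? l X) ×-dec (l X <? c) ×-dec (c ≤? r X) ×-dec (r X <? hi)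

    Shifted : Fin n → Fin n → Set
    Shifted X Y = l X < l Y × r X < r Y

    -- Both chords pass over `c`, which gives the middle inequality.
    new-cross : ∀ {X Y} → New X → New Y → Shifted X Y → CircleAdj A X Y
    new-cross (_ , _ , c≤rX , _) (_ , lY<c , _ , _) (ll , rr) = inj₁ (ll , <-≤-trans lY<c c≤rX , rr)

    no-new-chain : ∀ {w x y z} → New w → New x → New y → New z →
      Shifted w x → Shifted x y → Shifted y z → ⊥
    no-new-chain = no-4-chain {A = A} noK4 {New} {Shifted}
      (λ { (p , q) (p′ , q′) → <-trans p p′ , <-trans q q′ }) new-cross

    shifted? : ∀ X Y → Dec (Shifted X Y)
    shifted? X Y = (l X <? l Y) ×-dec (r X <? r Y)

    open Height new? shifted? no-new-chain

    old-seen? = seen? (stub? lo hi) (inn hi) (col st) lo hi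

    -- The stubs use `load st lo hi` of the `κ` colours, so `room` leaves three that no stub
    -- carries.
    palette = choose 3 (λ k → ¬? (old-seen? k))
      (+-cancelˡ-≤ (load st lo hi) _ _ (subst (load st lo hi + 3 ≤_) (sym (cnt-∁ old-seen?)) room))

    e : Fin 3 → Fin κ
    e = proj₁ palette

    e-injective : ∀ i j → e i ≡ e j → i ≡ j
    e-injective = proj₂ (proj₂ palette)

    fresh : ∀ {X} i → Stub lo hi X → col st X ≢ e i
    fresh {X} i u q = proj₁ (proj₂ palette) i (X , u , inn-range u , q)

    -- A chord over the cut forces `lo < c < hi`, whereas the pivots of stubs are never strictly
    -- inside the segment.
    piv≢c : ∀ {X Z} → Stub lo hi X → New Z → piv st X ≢ c
    piv≢c uX (lo≤l , l<c , c≤r , r<hi) q with piv-out st uX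
    ... | inj₁ p≤lo = <⇒≱ (≤-<-trans lo≤l l<c) (subst (_≤ lo) q p≤lo)
    ... | inj₂ hi≤p = <⇒≱ (≤-<-trans c≤r r<hi) (subst (hi ≤_) q hi≤p)

    stub-old : ∀ {X} → Stub lo hi X → ¬ New X
    stub-old (inj₁ (l<lo , _)) (lo≤l , _) = <⇒≱ l<lo lo≤l
    stub-old (inj₂ (_ , _ , hi≤r)) (_ , _ , _ , r<hi) = <⇒≱ r<hi hi≤r

    module L = Extension {U′ = Stub lo c} (stub? lo hi) (stub? lo c) new? {inn′ = inn c} {out′ = out c}
      (coherent st) c e e-injective height
    module R = Extension {U′ = Stub c hi} (stub? lo hi) (stub? c hi) new? {inn′ = inn hi} {out′ = out hi}
      (coherent st) c e e-injective height

    old-L : ∀ {X} → Stub lo c X → ¬ New X →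
      Stub lo hi X × inn c X ≡ inn hi X × out c X ≡ out hi X
    old-L (inj₁ (l<lo , lo≤r , r<c)) _ =
      inj₁ (l<lo , lo≤r , r<hi) , trans (innL r<c) (sym (innL r<hi)) , trans (outL r<c) (sym (outL r<hi))
      where r<hi = <-≤-trans r<c c≤hi
    old-L {X} (inj₂ (lo≤l , l<c , c≤r)) ¬new =
      inj₂ (lo≤l , <-≤-trans l<c c≤hi , hi≤r) , trans (innR c≤r) (sym (innR hi≤r)) , trans (outR c≤r) (sym (outR hi≤r))
      where hi≤r = ≮⇒≥ λ r<hi → ¬new (lo≤l , l<c , c≤r , r<hi)

    old-R : ∀ {X} → Stub c hi X → ¬ New X →
      Stub lo hi X × inn hi X ≡ inn hi X × out hi X ≡ out hi X
    old-R (inj₁ (l<c , c≤r , r<hi)) ¬new =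
      inj₁ (≰⇒> (λ lo≤l → ¬new (lo≤l , l<c , c≤r , r<hi)) , ≤-trans lo≤c c≤r , r<hi) , refl , refl
    old-R (inj₂ (c≤l , l<hi , hi≤r)) _ = inj₂ (≤-trans lo≤c c≤l , l<hi , hi≤r) , refl , refl

    below-L : ∀ {K} → Stub lo hi K → inn hi K < c → Stub lo c K
    below-L (inj₁ (l<lo , lo≤r , r<hi)) i = inj₁ (l<lo , lo≤r , subst (_< c) (innL r<hi) i)
    below-L (inj₂ (lo≤l , l<hi , hi≤r)) i = inj₂ (lo≤l , subst (_< c) (innR hi≤r) i , ≤-trans c≤hi hi≤r)

    above-R : ∀ {K} → Stub lo hi K → c ≤ inn hi K → Stub c hi K
    above-R (inj₁ (l<lo , lo≤r , r<hi)) i = inj₁ (<-≤-trans l<lo lo≤c , subst (c ≤_) (innL r<hi) i , r<hi)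
    above-R (inj₂ (lo≤l , l<hi , hi≤r)) i = inj₂ (subst (c ≤_) (innR hi≤r) i , l<hi , hi≤r)

    -- The upper bound by `X` keeps `K` to the left of `c`. The right piece relies on the lower
    -- bound by `Y`, which is why `descend` records `inn Y ≤ inn K`.
    between-L : ∀ {X K Y} → Stub lo c X → ¬ New X → Stub lo c Y → ¬ New Y → Stub lo hi K →
      inn hi Y ≤ inn hi K → inn hi K < inn hi X → Stub lo c K × ¬ New K
    between-L {X} uX oX _ _ uK _ K<X = below-L uK (<-trans K<X
      (subst (_< c) (proj₁ (proj₂ (old-L {X} uX oX))) (proj₂ (inn-range uX)))) , stub-old uK

    between-R : ∀ {X K Y} → Stub c hi X → ¬ New X → Stub c hi Y → ¬ New Y → Stub lo hi K →
      inn hi Y ≤ inn hi K → inn hi K < inn hi X → Stub c hi K × ¬ New K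
    between-R _ _ uY _ uK Y≤K _ = above-R uK (≤-trans (proj₁ (inn-range uY)) Y≤K) , stub-old uK

    new-L : ∀ {X} → New X → Stub lo c X
    new-L (lo≤l , l<c , c≤r , r<hi) = inj₂ (lo≤l , l<c , c≤r)

    new-R : ∀ {X} → New X → Stub c hi X
    new-R (lo≤l , l<c , c≤r , r<hi) = inj₁ (l<c , c≤r , r<hi)

    -- For either piece, the cut chords come at one extreme of the cyclic order of outer ends: first
    -- for the left piece, last for the right one.
    separated-L : ∀ {X Y} → New X → Stub lo c Y → ¬ New Y → out c X < out c Y
    separated-L {X} (_ , _ , c≤rX , rX<hi) (inj₁ (_ , _ , rY<c)) _ =
      subst₂ _<_ (sym (outR c≤rX)) (sym (outL rY<c)) (<-≤-trans (r<N X) (m≤m+n N _))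
    separated-L {X} {Y} (_ , _ , c≤rX , rX<hi) (inj₂ (lo≤lY , lY<c , c≤rY)) ¬newY =
      subst₂ _<_ (sym (outR c≤rX)) (sym (outR c≤rY))
        (<-≤-trans rX<hi (≮⇒≥ λ rY<hi → ¬newY (lo≤lY , lY<c , c≤rY , rY<hi)))

    separated-R : ∀ {X Y} → New X → Stub c hi Y → ¬ New Y → out hi Y < out hi X
    separated-R {X} (lo≤lX , _ , _ , rX<hi) (inj₁ (lY<c , c≤rY , rY<hi)) ¬newY =
      subst₂ _<_ (sym (outL rY<hi)) (sym (outL rX<hi))
        (+-monoʳ-< N (<-≤-trans (≰⇒> λ lo≤lY → ¬newY (lo≤lY , lY<c , c≤rY , rY<hi)) lo≤lX))
    separated-R {X} {Y} (lo≤lX , _ , _ , rX<hi) (inj₂ (_ , _ , hi≤rY)) _ =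
      subst₂ _<_ (sym (outR hi≤rY)) (sym (outL rX<hi)) (<-≤-trans (r<N Y) (m≤m+n N _))

    -- The inner end of a cut chord is `l` for the left piece and `r` for the right one. `Before`
    -- amounts to `Shifted` either way, so one height function serves both pieces.
    shifted⇒L : ∀ {X Y} → New X → New Y → Shifted X Y → Before c X Y
    shifted⇒L (_ , _ , cX , _) (_ , _ , cY , _) (ll , rr) =
      subst₂ _<_ (sym (innR cX)) (sym (innR cY)) ll , subst₂ _<_ (sym (outR cX)) (sym (outR cY)) rr

    L⇒shifted : ∀ {X Y} → New X → New Y → Before c X Y → Shifted X Y
    L⇒shifted (_ , _ , cX , _) (_ , _ , cY , _) (i , o) =
      subst₂ _<_ (innR cX) (innR cY) i , subst₂ _<_ (outR cX) (outR cY) o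

    shifted⇒R : ∀ {X Y} → New X → New Y → Shifted X Y → Before hi X Y
    shifted⇒R (_ , _ , _ , hX) (_ , _ , _ , hY) (ll , rr) =
      subst₂ _<_ (sym (innL hX)) (sym (innL hY)) rr
      , subst₂ _<_ (sym (outL hX)) (sym (outL hY)) (+-monoʳ-< N ll)

    R⇒shifted : ∀ {X Y} → New X → New Y → Before hi X Y → Shifted X Y
    R⇒shifted (_ , _ , _ , hX) (_ , _ , _ , hY) (i , o) =
      +-cancelˡ-< N _ _ (subst₂ _<_ (outL hX) (outL hY) o) , subst₂ _<_ (innL hX) (innL hY) i

    pred-via : ∀ {S : Fin n → Fin n → Set} → (∀ {X Y} → New X → New Y → Shifted X Y → S X Y) →
      ∀ {X} → New X → toℕ (height X) ≡ 0 ⊎ ∃ λ K → New K × S K X × toℕ (height X) ≡ suc (toℕ (height K))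
    pred-via conv nX with height-pred nX
    ... | inj₁ z = inj₁ z
    ... | inj₂ (K , nK , KX , q) = inj₂ (K , nK , conv nK nX KX , q)

    module L′ = L.Preserve fresh piv≢c old-L between-L new-L (inj₁ separated-L)
      (λ nX nY b → height-mono nX nY (L⇒shifted nX nY b)) (pred-via shifted⇒L)
    module R′ = R.Preserve fresh piv≢c old-R between-R new-R (inj₂ separated-R)
      (λ nX nY b → height-mono nX nY (R⇒shifted nX nY b)) (pred-via shifted⇒R)

    piv-out-L : ∀ {X} → Stub lo c X → L.piv′ X ≤ lo ⊎ c ≤ L.piv′ X
    piv-out-L {X} uX with new? X
    ... | yes _ = inj₂ ≤-refl
    ... | no oX with piv-out st (proj₁ (old-L uX oX))
    ...   | inj₁ p≤lo = inj₁ p≤lo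
    ...   | inj₂ hi≤p = inj₂ (≤-trans c≤hi hi≤p)

    piv-out-R : ∀ {X} → Stub c hi X → R.piv′ X ≤ c ⊎ hi ≤ R.piv′ X
    piv-out-R {X} uX with new? X
    ... | yes _ = inj₁ ≤-refl
    ... | no oX with piv-out st (proj₁ (old-R uX oX))
    ...   | inj₁ p≤lo = inj₁ (≤-trans p≤lo lo≤c)
    ...   | inj₂ hi≤p = inj₂ hi≤p

    stL : State lo c
    stL = record { coherent = L′.extended ; piv-out = piv-out-L }

    stR : State c hi
    stR = record { coherent = R′.extended ; piv-out = piv-out-R }

    load-L : ∀ x y → load stL x y ≤ load st x y + 3
    load-L = L′.visible-extended

    load-R : ∀ x y → load stR x y ≤ load st x y + 3
    load-R = R′.visible-extended

    -- Crossing puts one end of `Y` between the ends of `X`, hence inside the piece; the other end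
    -- stays outside the segment.
    stub-L : ∀ {X Y} → In lo c X → Stub lo hi Y → CircleAdj A X Y → Stub lo c Y
    stub-L (lo≤lX , rX<c) (inj₁ (lY<lo , lo≤rY , rY<hi)) (inj₁ (lX<lY , _)) =
      ⊥-elim (<-asym (<-≤-trans lY<lo lo≤lX) lX<lY)
    stub-L (lo≤lX , rX<c) (inj₁ (lY<lo , lo≤rY , rY<hi)) (inj₂ (_ , _ , rY<rX)) =
      inj₁ (lY<lo , lo≤rY , <-trans rY<rX rX<c)
    stub-L (lo≤lX , rX<c) (inj₂ (lo≤lY , lY<hi , hi≤rY)) (inj₁ (_ , lY<rX , _)) =
      inj₂ (lo≤lY , <-trans lY<rX rX<c , ≤-trans c≤hi hi≤rY)
    stub-L (lo≤lX , rX<c) (inj₂ (lo≤lY , lY<hi , hi≤rY)) (inj₂ (_ , _ , rY<rX)) =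
      ⊥-elim (<⇒≱ (<-trans rY<rX rX<c) (≤-trans c≤hi hi≤rY))

    stub-R : ∀ {X Y} → In c hi X → Stub lo hi Y → CircleAdj A X Y → Stub c hi Y
    stub-R (c≤lX , rX<hi) (inj₁ (lY<lo , lo≤rY , rY<hi)) (inj₁ (lX<lY , _)) =
      ⊥-elim (<-asym (<-≤-trans lY<lo (≤-trans lo≤c c≤lX)) lX<lY)
    stub-R (c≤lX , rX<hi) (inj₁ (lY<lo , lo≤rY , rY<hi)) (inj₂ (_ , lX<rY , _)) =
      inj₁ (<-≤-trans lY<lo lo≤c , ≤-trans c≤lX (<⇒≤ lX<rY) , rY<hi)
    stub-R (c≤lX , rX<hi) (inj₂ (lo≤lY , lY<hi , hi≤rY)) (inj₁ (lX<lY , _)) =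
      inj₂ (≤-trans c≤lX (<⇒≤ lX<lY) , lY<hi , hi≤rY)
    stub-R (c≤lX , rX<hi) (inj₂ (lo≤lY , lY<hi , hi≤rY)) (inj₂ (_ , _ , rY<rX)) =
      ⊥-elim (<⇒≱ (<-trans rY<rX rX<hi) hi≤rY)

    data Part (X : Fin n) : Set where
      cut   : New X → Part X
      inside-L : In lo c X → Part X
      inside-R : In c hi X → Part X

    part : ∀ {X} → In lo hi X → Part X
    part {X} (lo≤l , r<hi) with r X <? c | c ≤? l X
    ... | yes r<c | _       = inside-L (lo≤l , r<c)
    ... | no _    | yes c≤l = inside-R (c≤l , r<hi)
    ... | no r≮c  | no c≰l  = cut (lo≤l , ≰⇒> c≰l , ≮⇒≥ r≮c , r<hi)

    glue : Solution lo c (col stL) → Solution c hi (col stR) → Solution lo hi (col st)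
    glue (f , f-proper , f-stub) (h , h-proper , h-stub) =
      colour
      , (λ iX iY → proper (part iX) (part iY))
      , (λ iX → proper-stub (part iX))
      where
      rest : Fin n → Fin κ
      rest X = pick (r X <? c) (f X) (h X)
      colour : Fin n → Fin κ
      colour X = pick (new? X) (e (height X)) (rest X)
      colour-new : ∀ {X} → New X → colour X ≡ e (height X)
      colour-new {X} = pick-yes (new? X)
      colour-left : ∀ {X} → In lo c X → colour X ≡ f X
      colour-left {X} (_ , r<c) = trans (pick-no (new? X) λ { (_ , _ , c≤r , _) → <⇒≱ r<c c≤r })
        (pick-yes (r X <? c) r<c)
      colour-right : ∀ {X} → In c hi X → colour X ≡ h X
      colour-right {X} (c≤l , _) = trans (pick-no (new? X) λ { (_ , l<c , _) → <⇒≱ l<c c≤l })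
        (pick-no (r X <? c) λ r<c → <-asym r<c (≤-<-trans c≤l (l<r X)))
      height≢ : ∀ {X Y} → New X → New Y → CircleAdj A X Y → height X ≢ height Y
      height≢ nX nY (inj₁ (ll , _ , rr)) q = <-irrefl (cong toℕ q) (height-mono nX nY (ll , rr))
      height≢ nX nY (inj₂ (ll , _ , rr)) q = <-irrefl (cong toℕ (sym q)) (height-mono nY nX (ll , rr))
      apart : ∀ {X Y} → In lo c X → In c hi Y → ¬ CircleAdj A X Y
      apart (_ , rX<c) (c≤lY , _) (inj₁ (_ , lY<rX , _)) = <⇒≱ lY<rX (≤-trans (<⇒≤ rX<c) c≤lY)
      apart {X} (_ , rX<c) (c≤lY , _) (inj₂ (lY<lX , _)) =
        <⇒≱ (<-trans lY<lX (<-trans (l<r X) rX<c)) c≤lY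
      -- The cut chord is a stub of the left piece, whose solution already avoids its colour.
      left-new : ∀ {X Y} → In lo c X → New Y → CircleAdj A X Y → colour X ≢ colour Y
      left-new {Y = Y} iX nY cr q = f-stub iX (new-L nY) cr
        (trans (sym (colour-left iX)) (trans q (trans (colour-new nY) (sym (pick-yes (new? Y) nY)))))
      right-new : ∀ {X Y} → In c hi X → New Y → CircleAdj A X Y → colour X ≢ colour Y
      right-new {Y = Y} iX nY cr q = h-stub iX (new-R nY) cr
        (trans (sym (colour-right iX)) (trans q (trans (colour-new nY) (sym (pick-yes (new? Y) nY)))))
      proper : ∀ {X Y} → Part X → Part Y → CircleAdj A X Y → colour X ≢ colour Y
      proper (cut nX) (cut nY) cr q = height≢ nX nY cr
        (e-injective _ _ (trans (sym (colour-new nX)) (trans q (colour-new nY))))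
      proper (cut nX) (inside-L iY) cr q = left-new iY nX (Cross-sym {A _} {A _} cr) (sym q)
      proper (cut nX) (inside-R iY) cr q = right-new iY nX (Cross-sym {A _} {A _} cr) (sym q)
      proper (inside-L iX) (cut nY) cr = left-new iX nY cr
      proper (inside-L iX) (inside-L iY) cr q =
        f-proper iX iY cr (trans (sym (colour-left iX)) (trans q (colour-left iY)))
      proper (inside-L iX) (inside-R iY) cr _ = apart iX iY cr
      proper (inside-R iX) (cut nY) cr = right-new iX nY cr
      proper (inside-R iX) (inside-L iY) cr _ = apart iY iX (Cross-sym {A _} {A _} cr)
      proper (inside-R iX) (inside-R iY) cr q =
        h-proper iX iY cr (trans (sym (colour-right iX)) (trans q (colour-right iY)))
      proper-stub : ∀ {X Y} → Part X → Stub lo hi Y → CircleAdj A X Y → colour X ≢ col st Y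
      proper-stub {X} (cut nX) uY cr q = fresh (height X) uY (trans (sym q) (colour-new nX))
      proper-stub {Y = Y} (inside-L iX) uY cr q = f-stub iX (stub-L iX uY cr) cr
        (trans (sym (colour-left iX)) (trans q (sym (pick-no (new? Y) (stub-old uY)))))
      proper-stub {Y = Y} (inside-R iX) uY cr q = h-stub iX (stub-R iX uY cr) cr
        (trans (sym (colour-right iX)) (trans q (sym (pick-no (new? Y) (stub-old uY)))))

  -- Carrying out the plan and recursing.

  -- The whole plan is fixed before any cut is made, so its bounds must be relaxed by the three
  -- colours that each executed cut adds.
  Plan-mono : ∀ {C C′ : ℕ → ℕ → ℕ} {k s} → (∀ x y → C′ x y ≤ C x y + 3) →
    ∀ j {x y} → Plan C k s j x y → Plan C′ (k + 3) s j x y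
  Plan-mono C′≤ zero {x} {y} (ok , small) = ≤-trans (C′≤ x y) (+-monoˡ-≤ 3 ok) , small
  Plan-mono C′≤ (suc j) (c , x≤c , c≤y , p , q) = c , x≤c , c≤y , Plan-mono C′≤ j p , Plan-mono C′≤ j q

  -- Two budgets are kept: what a leaf will finally see and what is needed for the remaining cuts.
  -- Each cut lowers `j` by one and raises `k` and the bound on the load by three.
  carry-out : ∀ j {lo hi s k} (st : State lo hi) → Plan (load st) k s j lo hi →
    k + j * 3 ≤ 21 → load st lo hi + j * 3 ≤ κ →
    (∀ {lo hi} (st : State lo hi) → hi ∸ lo < s → load st lo hi ≤ 21 → Solution lo hi (col st)) →
    Solution lo hi (col st)
  carry-out zero {k = k} st (ok , small) k≤21 _ solve =
    solve st small (≤-trans ok (≤-trans (m≤m+n k 0) k≤21))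
  carry-out (suc j) {lo} {hi} {s} {k} st (c , lo≤c , c≤hi , planL , planR) k≤21 room solve =
    glue (carry-out j stL (Plan-mono load-L j planL) k+3≤21 (bound load-L ≤-refl c≤hi) solve)
         (carry-out j stR (Plan-mono load-R j planR) k+3≤21 (bound load-R lo≤c ≤-refl) solve)
    where
    room′ : (load st lo hi + 3) + j * 3 ≤ κ
    room′ = subst (_≤ κ) (sym (+-assoc (load st lo hi) 3 (j * 3))) room
    open Cut st lo≤c c≤hi (m+n≤o⇒m≤o (load st lo hi + 3) room′)
    k+3≤21 : (k + 3) + j * 3 ≤ 21
    k+3≤21 = subst (_≤ 21) (sym (+-assoc k 3 (j * 3))) k≤21
    bound : ∀ {C : ℕ → ℕ → ℕ} → (∀ x y → C x y ≤ load st x y + 3) →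
      ∀ {x y} → lo ≤ x → y ≤ hi → C x y + j * 3 ≤ κ
    bound C≤ {x} {y} lo≤x y≤hi = ≤-trans
      (+-monoˡ-≤ (j * 3) (≤-trans (C≤ x y) (+-monoˡ-≤ 3 (load-mono st lo≤x y≤hi)))) room′

  solve : 30 ≤ κ → ∀ s {lo hi} (st : State lo hi) → hi ∸ lo < s → load st lo hi ≤ 21 →
    Solution lo hi (col st)
  solve 30≤κ (suc s) {lo} {hi} st (s≤s size) few with suc lo <? hi
  -- A segment of at most one point contains no chord, so `col st` is a mere default.
  ... | no ¬big = col st , (λ iX _ _ → ⊥-elim (vacuous iX)) , λ iX _ _ → ⊥-elim (vacuous iX)
    where
    vacuous : ∀ {X} → In lo hi X → ⊥
    vacuous {X} (lo≤l , r<hi) = ¬big (≤-<-trans (≤-<-trans lo≤l (l<r X)) r<hi)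
  -- The budgets are `12 + 3 * 3 = 21` for the leaves and `21 + 3 * 3 = 30` for the colours.
  ... | yes big = carry-out 3 st (Staircase.greedy-plan (stub? lo hi) (coherent st) inn-injective
      (no-4-chain {A = A} noK4 (λ {x} {y} {z} → Before-trans {hi} {x} {y} {z}) stub-cross) big few)
    (≤-refl {21}) (≤-trans (+-monoˡ-≤ 9 few) 30≤κ)
    λ st′ small → solve 30≤κ s st′ (<-≤-trans small size)

  no-stub : ∀ {X} → ¬ Stub 0 N X
  no-stub (inj₁ (() , _))
  no-stub {X} (inj₂ (_ , _ , N≤r)) = <⇒≱ (r<N X) N≤r

  -- The whole line has no stubs, so all three functions are defaults.
  initial : Fin κ → State 0 N
  initial k = record
    { col = λ _ → k
    ; piv = λ _ → 0
    ; ht = λ _ → 0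
    ; coherent = record
      { convex    = λ u → ⊥-elim (no-stub u)
      ; ascend    = λ u → ⊥-elim (no-stub u)
      ; descend   = λ u → ⊥-elim (no-stub u)
      ; class⇒col = λ u → ⊥-elim (no-stub u)
      ; col⇒class = λ u → ⊥-elim (no-stub u)
      }
    ; piv-out = λ u → ⊥-elim (no-stub u)
    }

  colouring : Fin κ → 30 ≤ κ → Σ (Fin n → Fin κ) λ f → ∀ i j → CircleAdj A i j → f i ≢ f j
  colouring k 30≤κ =
    let f , f-proper , _ = solve 30≤κ (suc N) (initial k) ≤-refl
          (≤-trans (≤-reflexive (cnt-none (seen? (stub? 0 N) (inn N) (λ _ → k) 0 N)
            λ { _ (_ , u , _) → no-stub u })) z≤n)
    in f , λ i j → f-proper (z≤n , r<N i) (z≤n , r<N j)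

-- Making all endpoints distinct.

bounded : ∀ {n} (f : Fin n → ℕ) → ∃ λ M → ∀ i → f i < M
bounded {zero}  f = 0 , λ ()
bounded {suc n} f =
  let M , f<M = bounded (f ∘ suc)
  in suc (f zero) ⊔ M , λ { zero → m≤m⊔n _ M ; (suc i) → ≤-trans (f<M i) (m≤n⊔m _ M) }

-- The leading digit decides, since `x * B + u` stays below the next multiple of `B`.
digits-< : ∀ {B x y u} v → u < B → x < y → x * B + u < y * B + v
digits-< {B} {x} {y} {u} v u<B x<y = begin-strict
  x * B + u  <⟨ +-monoʳ-< (x * B) u<B ⟩
  x * B + B  ≡⟨ +-comm (x * B) B ⟩
  suc x * B  ≤⟨ *-monoˡ-≤ B x<y ⟩
  y * B      ≤⟨ m≤m+n (y * B) v ⟩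
  y * B + v  ∎
  where open ≤-Reasoning

digits-cancel-< : ∀ {B x y u v} → v < B → x * B + u < y * B + v → x < y ⊎ (x ≡ y × u < v)
digits-cancel-< {B} {x} {y} {u} {v} v<B lt with <-cmp x y
... | tri< x<y _ _  = inj₁ x<y
... | tri≈ _ refl _ = inj₂ (refl , +-cancelˡ-< (x * B) u v lt)
... | tri> _ _ y<x  = ⊥-elim (<-asym lt (digits-< u v<B y<x))

digits-injective : ∀ {B x y u v} → u < B → v < B → x * B + u ≡ y * B + v → x ≡ y × u ≡ v
digits-injective {B} {x} {y} {u} {v} u<B v<B eq with <-cmp x y
... | tri< x<y _ _  = ⊥-elim (<-irrefl eq (digits-< v u<B x<y))
... | tri≈ _ refl _ = refl , +-cancelˡ-≡ (x * B) u v eq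
... | tri> _ _ y<x  = ⊥-elim (<-irrefl (sym eq) (digits-< u v<B y<x))

-- Chords sharing an endpoint x get distinct ones in the block [x * B, (x + 1) * B): closing ends come
-- before opening ends, and within each kind the order makes the chords nested, so that no new
-- crossing arises.
module Perturb {n : ℕ} (A : Fin n → Chord) (distinct : DistinctChords A)
  (M : ℕ) (r<M : ∀ X → right (A X) < M) where

  a b : Fin n → ℕ
  a X = left (A X)
  b X = right (A X)

  a<b : ∀ X → a X < b X
  a<b X = left<right (A X)

  a<M : ∀ X → a X < M
  a<M X = <-trans (a<b X) (r<M X)

  B : ℕ
  B = M + M

  -- The summand `M` puts openings after closings. The subtraction reverses the order: of chords
  -- with a common left end the longest opens first, and of those with a common right end the
  -- shortest closes first.
  opening closing : Fin n → ℕ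
  opening X = M + (M ∸ suc (b X))
  closing X = M ∸ suc (a X)

  ∸suc<M : ∀ {x} → x < M → M ∸ suc x < M
  ∸suc<M {x} x<M = ∸-monoʳ-< z<s x<M

  closing<M : ∀ X → closing X < M
  closing<M X = ∸suc<M (a<M X)

  closing<B : ∀ X → closing X < B
  closing<B X = <-≤-trans (closing<M X) (m≤m+n M M)

  opening<B : ∀ X → opening X < B
  opening<B X = +-monoʳ-< M (∸suc<M (r<M X))

  ∸suc-cancel : ∀ {x y} → M ∸ suc x < M ∸ suc y → y < x
  ∸suc-cancel {x} {y} lt = ≰⇒> λ x≤y → <⇒≱ lt (∸-monoʳ-≤ M (s≤s x≤y))

  separate : Fin n → Chord
  separate X = chord (a X * B + opening X) (b X * B + closing X) (digits-< (closing X) (opening<B X) (a<b X))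

  left-injective : ∀ {X Y} → left (separate X) ≡ left (separate Y) → X ≡ Y
  left-injective {X} {Y} q =
    let a≡ , o≡ = digits-injective (opening<B X) (opening<B Y) q
    in distinct X Y a≡ (ℕ.suc-injective (∸-cancelˡ-≡ (r<M X) (r<M Y) (+-cancelˡ-≡ M _ _ o≡)))

  right-injective : ∀ {X Y} → right (separate X) ≡ right (separate Y) → X ≡ Y
  right-injective {X} {Y} q =
    let b≡ , c≡ = digits-injective (closing<B X) (closing<B Y) q
    in distinct X Y (ℕ.suc-injective (∸-cancelˡ-≡ (a<M X) (a<M Y) c≡)) b≡

  left≢right : ∀ {X Y} → left (separate X) ≢ right (separate Y)
  left≢right {X} {Y} q = <⇒≱ (closing<M Y)
    (subst (M ≤_) (proj₂ (digits-injective {x = a X} {y = b Y} (opening<B X) (closing<B Y) q)) (m≤m+n M _))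

  right<MB : ∀ X → right (separate X) < M * B
  right<MB X = subst (right (separate X) <_) (+-identityʳ (M * B)) (digits-< 0 (closing<B X) (r<M X))

  Interleave : Chord → Chord → Set
  Interleave c d = left c < left d × left d < right c × right c < right d

  interleave⇒separate : ∀ {X Y} → Interleave (A X) (A Y) → Interleave (separate X) (separate Y)
  interleave⇒separate {X} {Y} (p , q , s) =
    digits-< (opening Y) (opening<B X) p , digits-< (closing X) (opening<B Y) q
    , digits-< (closing Y) (closing<B X) s

  -- A new crossing would have to break a tie between endpoints. A left end tied with a right end
  -- comes after it, and the reversed order at a common left or right end contradicts the comparison
  -- of the other ends.
  separate⇒interleave : ∀ {X Y} → Interleave (separate X) (separate Y) → Interleave (A X) (A Y)
  separate⇒interleave {X} {Y} (p , q , s)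
    with digits-cancel-< (opening<B Y) p | digits-cancel-< (closing<B X) q | digits-cancel-< (closing<B Y) s
  ... | inj₁ aa | inj₁ ab | inj₁ bb = aa , ab , bb
  ... | _ | inj₂ (_ , lt) | _ = ⊥-elim (<⇒≱ (<-trans lt (closing<M X)) (m≤m+n M _))
  ... | inj₁ aa | _ | inj₂ (_ , lt) = ⊥-elim (<-asym aa (∸suc-cancel lt))
  ... | inj₂ (_ , lt) | _ | inj₁ bb = ⊥-elim (<-asym bb (∸suc-cancel (+-cancelˡ-< M _ _ lt)))
  ... | inj₂ (_ , lt) | _ | inj₂ (b≡ , _) = ⊥-elim (<-irrefl (sym b≡) (∸suc-cancel (+-cancelˡ-< M _ _ lt)))

  adj⇒separate : ∀ {X Y} → CircleAdj A X Y → CircleAdj separate X Y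
  adj⇒separate (inj₁ p) = inj₁ (interleave⇒separate p)
  adj⇒separate (inj₂ p) = inj₂ (interleave⇒separate p)

  separate⇒adj : ∀ {X Y} → CircleAdj separate X Y → CircleAdj A X Y
  separate⇒adj (inj₁ p) = inj₁ (separate⇒interleave p)
  separate⇒adj (inj₂ p) = inj₂ (separate⇒interleave p)

  K4-free : ¬ ContainsK4 A → ¬ ContainsK4 separate
  K4-free noK4 (w , x , y , z , ≢s , wx , wy , wz , xy , xz , yz) =
    noK4 (w , x , y , z , ≢s , separate⇒adj wx , separate⇒adj wy , separate⇒adj wz
         , separate⇒adj xy , separate⇒adj xz , separate⇒adj yz)

theorem1 : (n : ℕ) (A : Fin n → Chord) → DistinctChords A → ¬ ContainsK4 A →
    Σ (Fin n → Fin 30) (λ col → ProperColoring A 30 col)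
theorem1 n A distinct noK4 =
  let M , r<M = bounded (right ∘ A)
      open Perturb A distinct M r<M
      col , proper = Segments.colouring separate (K4-free noK4) (M * B) right<MB
                       left-injective right-injective left≢right zero ≤-refl
  in col , λ i j adj → proper i j (adj⇒separate adj)
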